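{- Let $(S,K,I)$ be an active split graph. If $\Phi(S)$ is connected, then $S$ is indecomposable.
   Context: All graphs are finite and simple. A split graph is a graph $S$ whose vertex set is a disjoint union $V(S)=K\,\dot\cup\,I$ with $K$ a clique and $I$ an independent set; $(K,I)$ is called a bipartition of $S$, and $(S,K,I)$ denotes $S$ together with this fixed bipartition. A 2-switch in a graph $G$ is performed on four distinct vertices $a,b,c,d$ with $ab,cd\in E(G)$ and $ac,bd\notin E(G)$: it deletes $ab,cd$ and adds $ac,bd$; $a,b,c,d$ are said to participate in it. A vertex is active in $G$ if it participates in some 2-switch on $G$, otherwise inactive; $act(G)$ is the set of active vertices, and $G$ is active if $act(G)=V(G)$. For a split graph $(S,K,I)$ and distinct $u,v\in I$, $\sigma_{uv}(S)$ is the number of induced subgraphs of $S$ isomorphic to $P_4$ containing both $u$ and $v$. The factor graph $\Phi(S)$ is the loopless multigraph with vertex set $I$ having exactly $\sigma_{uv}(S)$ parallel edges between $u$ and $v$. Graph notions (connected, complete, clique, etc.) applied to $\Phi(S)$ refer to its underlying simple graph, in which $u\sim v$ iff $\sigma_{uv}(S)\ge1$. Tyshkevich composition: for a split graph $(S,K,I)$ and a graph $G$ vertex-disjoint from $S$, $S\circ G$ is the graph with vertex set $V(S)\cup V(G)$ and edge set $E(S)\cup E(G)\cup\{xy: x\in K,\ y\in V(G)\}$. A graph $G$ is decomposable if $G=S\circ H$ for some split graph $S$ and graph $H$, each with at least one vertex; otherwise $G$ is indecomposable. -}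

module Defs where

open import Data.Fin.Base using (Fin; toℕ)
open import Data.Fin.Properties using (_≟_; any?; all?)
open import Data.Fin.Subset
  using (Subset; _∈_; _∉_; _⊆_; _∩_; _∪_; ⊤; ⊥; inside; outside; Nonempty)
open import Data.Fin.Subset.Properties
  using (_∈?_; _⊆?_; ∈⊤; x∈p∩q⁺; x∈p∪q⁺)
open import Data.List.Base as List using (List; length; filter; _++_)
open import Data.List.Properties using (filter-≐)
open import Data.Nat.Base using (ℕ; zero; suc; _≤_)
import Data.Nat.Properties as ℕ
open import Data.Product.Base using (Σ; Σ-syntax; ∃; ∃-syntax; _×_; _,_; proj₁; proj₂)
open import Data.Sum.Base using (_⊎_; inj₁; inj₂)
open import Data.Vec.Base as Vec using (Vec; lookup; tabulate; here; there)
open import Data.Vec.Properties using (lookup∘tabulate)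
open import Function.Base using (_∘_)
open import Function.Bundles using (_↔_; _⇔_; mk↔ₛ′; mk⇔; Inverse; Equivalence)
open import Level using (0ℓ)
open import Relation.Binary.Construct.Closure.ReflexiveTransitive using (Star)
open import Relation.Binary.Core using (Rel)
open import Relation.Binary.Definitions using (Decidable; Symmetric)
open import Relation.Binary.PropositionalEquality
  using (_≡_; _≢_; refl; sym; trans; cong; subst; subst₂)
open import Relation.Nullary.Decidable
  using (Dec; yes; no; map′; _×-dec_; _⊎-dec_; _→-dec_)
open import Relation.Nullary.Negation using (¬_; contradiction)
open import Relation.Unary as Pred using (Pred; _≐_)

private
  variable
    m n : ℕ

-- Vertices are labels drawn from Fin n, and the vertex set is an arbitrary
-- subset V of these labels.  Several graphs can thus share one label set, so
-- that disjointness, unions and equality of graphs are meant literally.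

record Graph (n : ℕ) : Set₁ where
  field
    V          : Subset n
    Adj        : Rel (Fin n) 0ℓ
    Adj?       : Decidable Adj
    Adj-sym    : Symmetric Adj
    Adj-irrefl : ∀ {v} → ¬ Adj v v
    Adj⇒∈V     : ∀ {u v} → Adj u v → u ∈ V

open Graph

infix 4 _≈_

_≈_ : Rel (Graph n) 0ℓ
G ≈ H = V G ≡ V H × (∀ u v → Adj G u v ⇔ Adj H u v)

Vertex : Graph n → Set
Vertex G = ∃[ v ] v ∈ V G

infix 4 _≅_

_≅_ : Graph m → Graph n → Set
G ≅ H = Σ[ f ∈ Vertex G ↔ Vertex H ]
  (∀ u v → Adj G (proj₁ u) (proj₁ v) ⇔
           Adj H (proj₁ (Inverse.to f u)) (proj₁ (Inverse.to f v)))

infix 20 _[_]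

_[_] : Graph n → Subset n → Graph n
G [ X ] = record
  { V          = X ∩ V G
  ; Adj        = λ u v → u ∈ X × v ∈ X × Adj G u v
  ; Adj?       = λ u v → (u ∈? X) ×-dec (v ∈? X) ×-dec Adj? G u v
  ; Adj-sym    = λ { (u∈X , v∈X , uv) → v∈X , u∈X , Adj-sym G uv }
  ; Adj-irrefl = λ { (_ , _ , vv) → Adj-irrefl G vv }
  ; Adj⇒∈V     = λ { (u∈X , _ , uv) → x∈p∩q⁺ (u∈X , Adj⇒∈V G uv) }
  }

Path : ∀ n → Graph n
Path n = record
  { V          = ⊤
  ; Adj        = λ i j → toℕ j ≡ suc (toℕ i) ⊎ toℕ i ≡ suc (toℕ j)
  ; Adj?       = λ i j → (toℕ j ℕ.≟ suc (toℕ i)) ⊎-dec (toℕ i ℕ.≟ suc (toℕ j))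
  ; Adj-sym    = λ { (inj₁ e) → inj₂ e ; (inj₂ e) → inj₁ e }
  ; Adj-irrefl = λ { (inj₁ e) → ℕ.1+n≢n (sym e) ; (inj₂ e) → ℕ.1+n≢n (sym e) }
  ; Adj⇒∈V     = λ _ → ∈⊤
  }

P₄ : Graph 4
P₄ = Path 4

-- The graph without vertices counts as connected.

Connected : Graph n → Set
Connected G = ∀ {u v} → u ∈ V G → v ∈ V G → Star (Adj G) u v

-- The data on which a 2-switch can be performed; that a, b, c, d are vertices
-- of G follows from Adj⇒∈V.

record 2-Switch (G : Graph n) (a b c d : Fin n) : Set where
  field
    a≢b : a ≢ b
    a≢c : a ≢ c
    a≢d : a ≢ d
    b≢c : b ≢ c
    b≢d : b ≢ d
    c≢d : c ≢ d
    ab  : Adj G a b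
    cd  : Adj G c d
    ¬ac : ¬ Adj G a c
    ¬bd : ¬ Adj G b d

act : Graph n → Pred (Fin n) 0ℓ
act G v = ∃[ a ] ∃[ b ] ∃[ c ] ∃[ d ]
  2-Switch G a b c d × (v ≡ a ⊎ v ≡ b ⊎ v ≡ c ⊎ v ≡ d)

Active : Graph n → Set
Active G = act G ≐ (_∈ V G)

record SplitGraph (n : ℕ) : Set₁ where
  field
    graph         : Graph n
    K I           : Subset n
    K∪I≡V         : K ∪ I ≡ V graph
    K∩I≡⊥         : K ∩ I ≡ ⊥
    K-clique      : ∀ {u v} → u ∈ K → v ∈ K → u ≢ v → Adj graph u v
    I-independent : ∀ {u v} → u ∈ I → v ∈ I → ¬ Adj graph u v

  K⊆V : K ⊆ V graph
  K⊆V x∈K = subst (_ ∈_) K∪I≡V (x∈p∪q⁺ (inj₁ x∈K))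

open SplitGraph

Disjoint : Subset n → Subset n → Set
Disjoint X Y = ∀ {v} → v ∈ X → v ∉ Y

compose : (S : SplitGraph n) (G : Graph n) →
          Disjoint (V (graph S)) (V G) → Graph n
compose S G disj = record
  { V          = V (graph S) ∪ V G
  ; Adj        = λ x y → Adj (graph S) x y ⊎ Adj G x y
                       ⊎ (x ∈ K S × y ∈ V G) ⊎ (y ∈ K S × x ∈ V G)
  ; Adj?       = λ x y → Adj? (graph S) x y ⊎-dec Adj? G x y
                       ⊎-dec ((x ∈? K S) ×-dec (y ∈? V G))
                       ⊎-dec ((y ∈? K S) ×-dec (x ∈? V G))
  ; Adj-sym    = λ { (inj₁ e)               → inj₁ (Adj-sym (graph S) e)
                   ; (inj₂ (inj₁ e))        → inj₂ (inj₁ (Adj-sym G e))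
                   ; (inj₂ (inj₂ (inj₁ e))) → inj₂ (inj₂ (inj₂ e))
                   ; (inj₂ (inj₂ (inj₂ e))) → inj₂ (inj₂ (inj₁ e)) }
  ; Adj-irrefl = λ { (inj₁ e)                       → Adj-irrefl (graph S) e
                   ; (inj₂ (inj₁ e))                → Adj-irrefl G e
                   ; (inj₂ (inj₂ (inj₁ (k , g)))) → disj (K⊆V S k) g
                   ; (inj₂ (inj₂ (inj₂ (k , g)))) → disj (K⊆V S k) g }
  ; Adj⇒∈V     = λ { (inj₁ e)                     → x∈p∪q⁺ (inj₁ (Adj⇒∈V (graph S) e))
                   ; (inj₂ (inj₁ e))              → x∈p∪q⁺ (inj₂ (Adj⇒∈V G e))
                   ; (inj₂ (inj₂ (inj₁ (k , _)))) → x∈p∪q⁺ (inj₁ (K⊆V S k))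
                   ; (inj₂ (inj₂ (inj₂ (_ , g)))) → x∈p∪q⁺ (inj₂ g) }
  }

-- Factors of G have their vertices in V G, so it is no restriction that they
-- are taken over the same labels as G.

Decomposable : Graph n → Set₁
Decomposable {n} G =
  Σ[ S ∈ SplitGraph n ] Σ[ H ∈ Graph n ]
  Σ[ disj ∈ Disjoint (V (graph S)) (V H) ]
    Nonempty (V (graph S)) × Nonempty (V H) × G ≈ compose S H disj

Indecomposable : Graph n → Set₁
Indecomposable G = ¬ Decomposable G

-- Deciding isomorphism with a graph on all labels, by searching through all
-- vectors of vertices (needed only for counting)

private
  ∈-irrelevant : ∀ {X : Subset n} {v} (p q : v ∈ X) → p ≡ q
  ∈-irrelevant here      here      = refl
  ∈-irrelevant (there p) (there q) = cong there (∈-irrelevant p q)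

  Vertex-≡ : ∀ {X : Subset n} {u v : ∃ (_∈ X)} → proj₁ u ≡ proj₁ v → u ≡ v
  Vertex-≡ {u = u , p} {v = .u , q} refl = cong (u ,_) (∈-irrelevant p q)

  anyVec? : ∀ {P : Pred (Vec (Fin m) n) 0ℓ} → Pred.Decidable P → Dec (∃ P)
  anyVec? {n = zero} P? =
    map′ (Vec.[] ,_) (λ { (Vec.[] , p) → p }) (P? Vec.[])
  anyVec? {n = suc n} P? =
    map′ (λ { (x , xs , p) → x Vec.∷ xs , p })
         (λ { (x Vec.∷ xs , p) → x , xs , p })
         (any? λ x → anyVec? λ xs → P? (x Vec.∷ xs))

  Labelling : Graph m → Graph n → Vec (Fin m) n → Set
  Labelling G H w =
      (∀ i → lookup w i ∈ V G)
    × (∀ u → u ∈ V G → ∃[ i ] lookup w i ≡ u)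
    × (∀ i j → lookup w i ≡ lookup w j → i ≡ j)
    × (∀ i j → (Adj G (lookup w i) (lookup w j) → Adj H i j)
             × (Adj H i j → Adj G (lookup w i) (lookup w j)))

  labelling? : (G : Graph m) (H : Graph n) → Pred.Decidable (Labelling G H)
  labelling? G H w =
    (all? λ i → lookup w i ∈? V G)
    ×-dec (all? λ u → (u ∈? V G) →-dec any? λ i → lookup w i ≟ u)
    ×-dec (all? λ i → all? λ j → (lookup w i ≟ lookup w j) →-dec (i ≟ j))
    ×-dec (all? λ i → all? λ j →
            (Adj? G (lookup w i) (lookup w j) →-dec Adj? H i j)
            ×-dec (Adj? H i j →-dec Adj? G (lookup w i) (lookup w j)))

  labelling⇒≅ : (G : Graph m) (H : Graph n) → (∀ i → i ∈ V H) →
                ∃ (Labelling G H) → G ≅ H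
  labelling⇒≅ G H full (w , mem , surj , inj , adj) =
    mk↔ₛ′ to from to∘from from∘to , to-adj
    where
    to : Vertex G → Vertex H
    to (u , u∈V) = proj₁ (surj u u∈V) , full _
    from : Vertex H → Vertex G
    from (i , _) = lookup w i , mem i
    w∘to : ∀ u → lookup w (proj₁ (to u)) ≡ proj₁ u
    w∘to (u , u∈V) = proj₂ (surj u u∈V)
    to∘from : ∀ i → to (from i) ≡ i
    to∘from i = Vertex-≡ (inj _ _ (w∘to (from i)))
    from∘to : ∀ u → from (to u) ≡ u
    from∘to u = Vertex-≡ (w∘to u)
    to-adj : ∀ u v → Adj G (proj₁ u) (proj₁ v) ⇔
                     Adj H (proj₁ (to u)) (proj₁ (to v))
    to-adj u v = mk⇔
      (λ e → proj₁ (adj _ _) (subst₂ (Adj G) (sym (w∘to u)) (sym (w∘to v)) e))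
      (λ e → subst₂ (Adj G) (w∘to u) (w∘to v) (proj₂ (adj _ _) e))

  ≅⇒labelling : (G : Graph m) (H : Graph n) → (∀ i → i ∈ V H) →
                G ≅ H → ∃ (Labelling G H)
  ≅⇒labelling G H full (f , adj) = w , mem , surj , inj , adj′
    where
    open Inverse f
    at : ∀ i → Vertex G
    at i = from (i , full i)
    to∘at : ∀ i → proj₁ (to (at i)) ≡ i
    to∘at i = cong proj₁ (strictlyInverseˡ (i , full i))
    w = tabulate (proj₁ ∘ at)
    w≡ : ∀ i → lookup w i ≡ proj₁ (at i)
    w≡ = lookup∘tabulate (proj₁ ∘ at)
    mem : ∀ i → lookup w i ∈ V G
    mem i = subst (_∈ V G) (sym (w≡ i)) (proj₂ (at i))
    surj : ∀ u → u ∈ V G → ∃[ i ] lookup w i ≡ u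
    surj u u∈V = proj₁ (to (u , u∈V)) , trans (w≡ _)
      (cong proj₁ (trans (cong from (Vertex-≡ refl)) (strictlyInverseʳ (u , u∈V))))
    inj : ∀ i j → lookup w i ≡ lookup w j → i ≡ j
    inj i j e = trans (sym (to∘at i)) (trans (cong (proj₁ ∘ to)
      (Vertex-≡ (trans (sym (w≡ i)) (trans e (w≡ j))))) (to∘at j))
    adj′ : ∀ i j → (Adj G (lookup w i) (lookup w j) → Adj H i j)
                 × (Adj H i j → Adj G (lookup w i) (lookup w j))
    adj′ i j =
      (λ e → subst₂ (Adj H) (to∘at i) (to∘at j)
               (Equivalence.to (adj _ _) (subst₂ (Adj G) (w≡ i) (w≡ j) e))) ,
      (λ e → subst₂ (Adj G) (sym (w≡ i)) (sym (w≡ j))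
               (Equivalence.from (adj _ _)
                 (subst₂ (Adj H) (sym (to∘at i)) (sym (to∘at j)) e)))

infix 4 _≅Path?_

_≅Path?_ : (G : Graph m) (n : ℕ) → Dec (G ≅ Path n)
G ≅Path? n = map′ (labelling⇒≅ G (Path n) (λ _ → ∈⊤)) (≅⇒labelling G (Path n) (λ _ → ∈⊤))
                  (anyVec? (labelling? G (Path n)))

-- Every subset of the labels, each exactly once.

subsets : ∀ n → List (Subset n)
subsets zero    = Vec.[] List.∷ List.[]
subsets (suc n) =
  List.map (outside Vec.∷_) (subsets n) ++ List.map (inside Vec.∷_) (subsets n)

-- An induced subgraph is determined by its vertex set X.

InducesP₄Through : Graph n → Fin n → Fin n → Subset n → Set
InducesP₄Through G u v X = X ⊆ V G × u ∈ X × v ∈ X × G [ X ] ≅ P₄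

inducesP₄Through? : (G : Graph n) (u v : Fin n) →
                    Pred.Decidable (InducesP₄Through G u v)
inducesP₄Through? G u v X =
  (X ⊆? V G) ×-dec (u ∈? X) ×-dec (v ∈? X) ×-dec (G [ X ] ≅Path? 4)

σ : Graph n → Fin n → Fin n → ℕ
σ {n} G u v = length (filter (inducesP₄Through? G u v) (subsets n))

σ-sym : (G : Graph n) (u v : Fin n) → σ G u v ≡ σ G v u
σ-sym {n} G u v = cong length
  (filter-≐ (inducesP₄Through? G u v) (inducesP₄Through? G v u)
    ( (λ (X⊆V , u∈X , v∈X , iso) → X⊆V , v∈X , u∈X , iso)
    , (λ (X⊆V , v∈X , u∈X , iso) → X⊆V , u∈X , v∈X , iso))
    (subsets n))

record Multigraph (n : ℕ) : Set where
  field
    V        : Subset n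
    mult     : Fin n → Fin n → ℕ
    mult-sym : ∀ u v → mult u v ≡ mult v u
    loopless : ∀ v → mult v v ≡ 0
    mult⇒∈V  : ∀ {u v} → 1 ≤ mult u v → u ∈ V

underlying : Multigraph n → Graph n
underlying M = record
  { V          = M.V
  ; Adj        = λ u v → 1 ≤ M.mult u v
  ; Adj?       = λ u v → 1 ℕ.≤? M.mult u v
  ; Adj-sym    = λ {u} {v} → subst (1 ≤_) (M.mult-sym u v)
  ; Adj-irrefl = λ {v} e → ℕ.1+n≰n (subst (1 ≤_) (M.loopless v) e)
  ; Adj⇒∈V     = M.mult⇒∈V
  }
  where module M = Multigraph M

Φ : SplitGraph n → Multigraph n
Φ {n} S = record
  { V        = I S
  ; mult     = mult
  ; mult-sym = mult-sym
  ; loopless = loopless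
  ; mult⇒∈V  = mult⇒∈V
  }
  where
  mult : Fin n → Fin n → ℕ
  mult u v with u ∈? I S | v ∈? I S | u ≟ v
  ... | yes _ | yes _ | no _ = σ (graph S) u v
  ... | _     | _     | _    = 0

  mult-sym : ∀ u v → mult u v ≡ mult v u
  mult-sym u v with u ∈? I S | v ∈? I S | u ≟ v | v ≟ u
  ... | yes _ | yes _ | no _    | no _    = σ-sym (graph S) u v
  ... | yes _ | yes _ | yes _   | yes _   = refl
  ... | yes _ | yes _ | yes u≡v | no v≢u  = contradiction (sym u≡v) v≢u
  ... | yes _ | yes _ | no u≢v  | yes v≡u = contradiction (sym v≡u) u≢v
  ... | yes _ | no _  | _       | _       = refl
  ... | no _  | yes _ | _       | _       = refl
  ... | no _  | no _  | _       | _       = refl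

  loopless : ∀ v → mult v v ≡ 0
  loopless v with v ∈? I S | v ≟ v
  ... | yes _ | yes _  = refl
  ... | yes _ | no v≢v = contradiction refl v≢v
  ... | no _  | _      = refl

  mult⇒∈V : ∀ {u v} → 1 ≤ mult u v → u ∈ I S
  mult⇒∈V {u} {v} p with u ∈? I S | v ∈? I S | u ≟ v
  ... | yes u∈I | _ | _ = u∈I
  mult⇒∈V () | no _ | _ | _

-- A 2-switch is an alternating 4-cycle.  In T ∘ H a vertex of H is joined to
-- all of K(T) and to none of I(T), so an alternating 4-cycle meeting H lies in
-- H.  An induced P₄ carries a 2-switch on its vertices, hence an edge of Φ(S)
-- cannot leave V(H).  As S is active, both T and H contain a 2-switch, and
-- every 2-switch of a split graph involves an independent vertex; so Φ(S) has
-- vertices both inside and outside V(H) and is not connected.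

{-# OPTIONS --safe #-}
module Submission where

open import Defs
open import Data.Fin.Base using (Fin)
open import Data.Fin.Patterns using (0F; 1F; 2F; 3F)
open import Data.Fin.Properties using (_≟_)
open import Data.Fin.Subset using (Subset; _∈_)
open import Data.Fin.Subset.Properties
  using (_∈?_; ∈⊤; ∉⊥; x∈p∩q⁺; p∩q⊆p; x∈p∪q⁺; x∈p∪q⁻)
open import Data.List.Base using (List; _∷_; length; filter)
open import Data.List.Relation.Unary.All using (_∷_)
open import Data.List.Relation.Unary.All.Properties using (all-filter)
open import Data.Nat.Base using (ℕ; _≤_)
open import Data.Product.Base using (∃; ∃-syntax; _×_; _,_; proj₁; proj₂)
open import Data.Sum.Base using (_⊎_; inj₁; inj₂)
open import Data.Vec.Properties.WithK using ([]=-irrelevant)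
open import Function.Base using (_∘_; case_of_)
open import Function.Bundles using (Inverse; Equivalence)
open import Level using (0ℓ)
open import Relation.Binary.Construct.Closure.ReflexiveTransitive using (Star; ε; _◅_)
open import Relation.Binary.PropositionalEquality
  using (_≡_; _≢_; refl; sym; trans; cong; subst; subst₂)
open import Relation.Nullary.Decidable using (yes; no)
open import Relation.Nullary.Negation using (¬_; contradiction)
open import Relation.Unary using (Pred; Decidable)

open Graph
open SplitGraph

private
  variable
    n : ℕ
    a b c d u v x y : Fin n

Participates : Fin n → (a b c d : Fin n) → Set
Participates v a b c d = v ≡ a ⊎ v ≡ b ⊎ v ≡ c ⊎ v ≡ d

module _ {G : Graph n} where

  -- Together with `2-Switch-rotate` this generates a Klein four-group acting transitively on the
  -- four positions, so any participant can be moved to the front.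
  2-Switch-flip : 2-Switch G a b c d → 2-Switch G b a d c
  2-Switch-flip s = record
    { a≢b = a≢b ∘ sym ; a≢c = b≢d ; a≢d = b≢c
    ; b≢c = a≢d ; b≢d = a≢c ; c≢d = c≢d ∘ sym
    ; ab = Adj-sym G ab ; cd = Adj-sym G cd ; ¬ac = ¬bd ; ¬bd = ¬ac }
    where open 2-Switch s

  2-Switch-rotate : 2-Switch G a b c d → 2-Switch G c d a b
  2-Switch-rotate s = record
    { a≢b = c≢d ; a≢c = a≢c ∘ sym ; a≢d = b≢c ∘ sym
    ; b≢c = a≢d ∘ sym ; b≢d = b≢d ∘ sym ; c≢d = a≢b
    ; ab = cd ; cd = ab ; ¬ac = ¬ac ∘ Adj-sym G ; ¬bd = ¬bd ∘ Adj-sym G }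
    where open 2-Switch s

  2-Switch-≈ : {H : Graph n} → G ≈ H → 2-Switch G a b c d → 2-Switch H a b c d
  2-Switch-≈ (_ , adj) s = record
    { a≢b = a≢b ; a≢c = a≢c ; a≢d = a≢d ; b≢c = b≢c ; b≢d = b≢d ; c≢d = c≢d
    ; ab = Equivalence.to (adj _ _) ab ; cd = Equivalence.to (adj _ _) cd
    ; ¬ac = ¬ac ∘ Equivalence.from (adj _ _)
    ; ¬bd = ¬bd ∘ Equivalence.from (adj _ _) }
    where open 2-Switch s

module _ (S : SplitGraph n) where

  K-or-I : v ∈ V (graph S) → v ∈ K S ⊎ v ∈ I S
  K-or-I v∈V = x∈p∪q⁻ (K S) (I S) (subst (_ ∈_) (sym (K∪I≡V S)) v∈V)

  I⊆V : v ∈ I S → v ∈ V (graph S)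
  I⊆V v∈I = subst (_ ∈_) (K∪I≡V S) (x∈p∪q⁺ (inj₂ v∈I))

  K-I-disjoint : v ∈ K S → ¬ v ∈ I S
  K-I-disjoint v∈K v∈I = ∉⊥ (subst (_ ∈_) (K∩I≡⊥ S) (x∈p∩q⁺ (v∈K , v∈I)))

  -- The non-edge `ac` cannot have both ends in the clique `K S`.
  2-Switch⇒I : 2-Switch (graph S) a b c d →
               ∃[ i ] i ∈ I S × Participates i a b c d
  2-Switch⇒I {a = a} {c = c} s
    with K-or-I (Adj⇒∈V (graph S) ab) | K-or-I (Adj⇒∈V (graph S) cd)
    where open 2-Switch s
  ... | inj₂ a∈I | _        = a , a∈I , inj₁ refl
  ... | _        | inj₂ c∈I = c , c∈I , inj₂ (inj₂ (inj₁ refl))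
  ... | inj₁ a∈K | inj₁ c∈K = contradiction (K-clique S a∈K c∈K a≢c) ¬ac
    where open 2-Switch s

module _ (T : SplitGraph n) (H : Graph n) (disj : Disjoint (V (graph T)) (V H)) where

  private
    G : Graph n
    G = compose T H disj

  H-neighbour : x ∈ V H → Adj G x y → y ∈ K T ⊎ y ∈ V H
  H-neighbour x∈H (inj₁ xy)                       = contradiction x∈H (disj (Adj⇒∈V (graph T) xy))
  H-neighbour x∈H (inj₂ (inj₁ xy))                = inj₂ (Adj⇒∈V H (Adj-sym H xy))
  H-neighbour x∈H (inj₂ (inj₂ (inj₁ (x∈K , _)))) = contradiction x∈H (disj (K⊆V T x∈K))
  H-neighbour x∈H (inj₂ (inj₂ (inj₂ (y∈K , _)))) = inj₁ y∈K

  H-non-neighbour : x ∈ V H → y ∈ V G → ¬ Adj G x y → y ∈ I T ⊎ y ∈ V H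
  H-non-neighbour x∈H y∈V ¬xy with x∈p∪q⁻ (V (graph T)) (V H) y∈V
  ... | inj₂ y∈H = inj₂ y∈H
  ... | inj₁ y∈T with K-or-I T y∈T
  ...   | inj₁ y∈K = contradiction (inj₂ (inj₂ (inj₂ (y∈K , x∈H)))) ¬xy
  ...   | inj₂ y∈I = inj₁ y∈I

  K-non-neighbour : x ∈ K T → y ∈ V G → x ≢ y → ¬ Adj G x y → y ∈ I T
  K-non-neighbour x∈K y∈V x≢y ¬xy with x∈p∪q⁻ (V (graph T)) (V H) y∈V
  ... | inj₂ y∈H = contradiction (inj₂ (inj₂ (inj₁ (x∈K , y∈H)))) ¬xy
  ... | inj₁ y∈T with K-or-I T y∈T
  ...   | inj₁ y∈K = contradiction (inj₁ (K-clique T x∈K y∈K x≢y)) ¬xy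
  ...   | inj₂ y∈I = y∈I

  I-neighbour : x ∈ I T → Adj G x y → y ∈ K T
  I-neighbour x∈I (inj₁ xy) with K-or-I T (Adj⇒∈V (graph T) (Adj-sym (graph T) xy))
  ... | inj₁ y∈K = y∈K
  ... | inj₂ y∈I = contradiction xy (I-independent T x∈I y∈I)
  I-neighbour x∈I (inj₂ (inj₁ xy))                = contradiction (Adj⇒∈V H xy) (disj (I⊆V T x∈I))
  I-neighbour x∈I (inj₂ (inj₂ (inj₁ (x∈K , _)))) = contradiction x∈I (K-I-disjoint T x∈K)
  I-neighbour x∈I (inj₂ (inj₂ (inj₂ (y∈K , _)))) = y∈K

  -- Edges and non-edges alternate around the cycle. Where it left `V H`, the next vertex would be
  -- forced into `K T` along an edge or `I T` along a non-edge; each case ends in a clash.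
  2-Switch-from-H : 2-Switch G a b c d → a ∈ V H →
                    ∀ {v} → Participates v a b c d → v ∈ V H
  2-Switch-from-H {a} {b} {c} {d} s a∈H = λ where
      (inj₁ refl)               → a∈H
      (inj₂ (inj₁ refl))        → b∈H
      (inj₂ (inj₂ (inj₁ refl))) → c∈H
      (inj₂ (inj₂ (inj₂ refl))) → d∈H
    where
    open 2-Switch s

    c∈V : c ∈ V G
    c∈V = Adj⇒∈V G cd

    d∈V : d ∈ V G
    d∈V = Adj⇒∈V G {d} {c} (Adj-sym G {c} {d} cd)

    b∈H : b ∈ V H
    b∈H with H-neighbour a∈H ab
    ... | inj₂ b∈H = b∈H
    -- From `b` in `K T` the non-edge `bd` puts `d` in `I T`, and then the edge `cd` puts `c` in
    -- `K T`, which is joined to all of `V H`, in particular to `a`.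
    ... | inj₁ b∈K = contradiction (inj₂ (inj₂ (inj₂ (c∈K , a∈H)))) ¬ac
      where
      c∈K : c ∈ K T
      c∈K = I-neighbour (K-non-neighbour b∈K d∈V b≢d ¬bd) (Adj-sym G {c} {d} cd)

    c∈H : c ∈ V H
    c∈H with H-non-neighbour a∈H c∈V ¬ac
    ... | inj₂ c∈H = c∈H
    ... | inj₁ c∈I = contradiction (inj₂ (inj₂ (inj₂ (I-neighbour c∈I cd , b∈H)))) ¬bd

    d∈H : d ∈ V H
    -- Outside `V H`, the vertex `d` would lie in `K T` as a neighbour of `c` and in `I T` as a
    -- non-neighbour of `b`.
    d∈H with H-neighbour c∈H cd | H-non-neighbour b∈H d∈V ¬bd
    ... | inj₂ d∈H | _        = d∈H
    ... | _        | inj₂ d∈H = d∈H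
    ... | inj₁ d∈K | inj₁ d∈I = contradiction d∈I (K-I-disjoint T d∈K)

  -- A symmetry puts `u` first, which yields `a` in `V H`; from `a` the original switch reaches `v`.
  2-Switch-within-H : 2-Switch G a b c d → Participates u a b c d →
                      Participates v a b c d → u ∈ V H → v ∈ V H
  2-Switch-within-H s (inj₁ refl) p u∈H = 2-Switch-from-H s u∈H p
  2-Switch-within-H s (inj₂ (inj₁ refl)) p u∈H =
    2-Switch-from-H s (2-Switch-from-H (2-Switch-flip s) u∈H (inj₂ (inj₁ refl))) p
  2-Switch-within-H s (inj₂ (inj₂ (inj₁ refl))) p u∈H =
    2-Switch-from-H s (2-Switch-from-H (2-Switch-rotate s) u∈H (inj₂ (inj₂ (inj₁ refl)))) p
  2-Switch-within-H s (inj₂ (inj₂ (inj₂ refl))) p u∈H =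
    2-Switch-from-H s (2-Switch-from-H (2-Switch-flip (2-Switch-rotate s)) u∈H
      (inj₂ (inj₂ (inj₂ refl)))) p

SwitchThrough : Graph n → Fin n → Fin n → Set
SwitchThrough G u v = ∃[ a ] ∃[ b ] ∃[ c ] ∃[ d ]
  2-Switch G a b c d × Participates u a b c d × Participates v a b c d

Vertex-≡ : {G : Graph n} {p q : Vertex G} → proj₁ p ≡ proj₁ q → p ≡ q
Vertex-≡ refl = cong (_ ,_) ([]=-irrelevant _ _)

-- Read along the path, the vertices of a `P₄` are already in switch order: the two end edges are
-- `ab` and `cd`, and vertices at distance two give the non-edges `ac` and `bd`.
inducesP₄Through⇒switchThrough : (G : Graph n) {X : Subset n} →
  InducesP₄Through G u v X → SwitchThrough G u v
inducesP₄Through⇒switchThrough {n = n} G {X} (X⊆V , u∈X , v∈X , f , adj) =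
  w 0F , w 1F , w 2F , w 3F , switch , participates u∈X , participates v∈X
  where
  open Inverse f

  at : Fin 4 → Vertex (G [ X ])
  at i = from (i , ∈⊤)

  w : Fin 4 → Fin n
  w = proj₁ ∘ at

  to∘at : ∀ i → proj₁ (to (at i)) ≡ i
  to∘at i = cong proj₁ (strictlyInverseˡ (i , ∈⊤))

  w∈X : ∀ i → w i ∈ X
  w∈X i = p∩q⊆p X (V G) (proj₂ (at i))

  w-injective : ∀ {i j} → w i ≡ w j → i ≡ j
  w-injective {i} {j} eq = trans (sym (to∘at i))
    (trans (cong (proj₁ ∘ to) (Vertex-≡ {G = G [ X ]} eq)) (to∘at j))

  w-edge : ∀ i j → Adj P₄ i j → Adj G (w i) (w j)
  w-edge i j ij = proj₂ (proj₂ (Equivalence.from (adj (at i) (at j))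
    (subst₂ (Adj P₄) (sym (to∘at i)) (sym (to∘at j)) ij)))

  w-edge⁻ : ∀ i j → Adj G (w i) (w j) → Adj P₄ i j
  w-edge⁻ i j ij = subst₂ (Adj P₄) (to∘at i) (to∘at j)
    (Equivalence.to (adj (at i) (at j)) (w∈X i , w∈X j , ij))

  switch : 2-Switch G (w 0F) (w 1F) (w 2F) (w 3F)
  switch = record
    { a≢b = λ eq → case w-injective eq of λ ()
    ; a≢c = λ eq → case w-injective eq of λ ()
    ; a≢d = λ eq → case w-injective eq of λ ()
    ; b≢c = λ eq → case w-injective eq of λ ()
    ; b≢d = λ eq → case w-injective eq of λ ()
    ; c≢d = λ eq → case w-injective eq of λ ()
    ; ab  = w-edge 0F 1F (inj₁ refl)
    ; cd  = w-edge 2F 3F (inj₁ refl)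
    ; ¬ac = λ e → case w-edge⁻ 0F 2F e of λ { (inj₁ ()) ; (inj₂ ()) }
    ; ¬bd = λ e → case w-edge⁻ 1F 3F e of λ { (inj₁ ()) ; (inj₂ ()) }
    }

  label : x ∈ X → ∃[ i ] x ≡ w i
  label {x} x∈X = proj₁ (to p) ,
    sym (cong proj₁ (trans (cong from (Vertex-≡ {G = P₄} refl)) (strictlyInverseʳ p)))
    where
    p : Vertex (G [ X ])
    p = x , x∈p∩q⁺ (x∈X , X⊆V x∈X)

  participates : x ∈ X → Participates x (w 0F) (w 1F) (w 2F) (w 3F)
  participates x∈X with label x∈X
  ... | 0F , eq = inj₁ eq
  ... | 1F , eq = inj₂ (inj₁ eq)
  ... | 2F , eq = inj₂ (inj₂ (inj₁ eq))
  ... | 3F , eq = inj₂ (inj₂ (inj₂ eq))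

filter-witness : {A : Set} {P : Pred A 0ℓ} (P? : Decidable P) (xs : List A) →
                 1 ≤ length (filter P? xs) → ∃ P
filter-witness P? xs 1≤ with filter P? xs | all-filter P? xs
... | x ∷ _ | px ∷ _ = x , px

-- Stated without the intermediate 1 ≤ σ u v: as the goal of the case split,
-- that inequality would be normalised through the whole search for P₄s.
Φ-edge⇒switchThrough : (S : SplitGraph n) → Adj (underlying (Φ S)) u v →
                       SwitchThrough (graph S) u v
Φ-edge⇒switchThrough {n} {u} {v} S uv with u ∈? I S | v ∈? I S | u ≟ v
-- In every other case the multiplicity is 0 by definition, so `uv` has the empty type `1 ≤ 0`.
... | yes _ | yes _ | no _ = inducesP₄Through⇒switchThrough (graph S)
  (proj₂ (filter-witness (inducesP₄Through? (graph S) u v) (subsets n) uv))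

theorem2p6 : ∀ {n} (S : SplitGraph n) →
    Active (SplitGraph.graph S) →
    Connected (underlying (Φ S)) →
    Indecomposable (SplitGraph.graph S)
theorem2p6 S (_ , V⊆act) connected
  (T , H , disj , (t , t∈T) , (h , h∈H) , S≈T∘H@(V≡ , _))
  with V⊆act (subst (t ∈_) (sym V≡) (x∈p∪q⁺ (inj₁ t∈T)))
     | V⊆act (subst (h ∈_) (sym V≡) (x∈p∪q⁺ (inj₂ h∈H)))
... | _ , _ , _ , _ , sₜ , t-in | _ , _ , _ , _ , sₕ , h-in
  -- The independent vertices come from the bipartition of `S`, not that of `T`, since they must be
  -- vertices of `Φ S`.
  with 2-Switch⇒I S sₜ | 2-Switch⇒I S sₕ
... | i , i∈I , i-in | j , j∈I , j-in =
  -- Membership in `V H` travels from `h` to `j` inside `sₕ`, along a walk in `Φ S` from `j` to `i`,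
  -- and from `i` to `t` inside `sₜ`, although `t` lies in `T`.
  disj t∈T (within sₜ i-in t-in (walk (connected j∈I i∈I) (within sₕ h-in j-in h∈H)))
  where
  within : 2-Switch (graph S) a b c d → Participates u a b c d →
           Participates v a b c d → u ∈ V H → v ∈ V H
  within s = 2-Switch-within-H T H disj (2-Switch-≈ S≈T∘H s)

  walk : Star (Adj (underlying (Φ S))) u v → u ∈ V H → v ∈ V H
  walk ε        u∈H = u∈H
  walk (e ◅ es) u∈H with Φ-edge⇒switchThrough S e
  ... | _ , _ , _ , _ , s , u-in , v-in = walk es (within s u-in v-in u∈H)
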